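{- Let $r\ge 3$, $\varepsilon>0$, and let $G$ be an $n$-vertex $K_r$-free graph such that for every pair of non-adjacent vertices $u,v\in V(G)$, the induced subgraph $G[N(u)\cap N(v)]$ contains at least $\varepsilon n^{r-2}$ copies of $K_{r-2}$. Then $G=F[\cdot]$ for some maximal $K_r$-free graph $F$ on at most $2^{O((\frac{1}{\varepsilon}+r)\log\frac{1}{\varepsilon})}$ vertices, where the implied constant in the $O(\cdot)$ is absolute.
   Context: $G=F[\cdot]$ means that $G$ is a blow-up of $F$: $G$ is obtained from $F$ by replacing each vertex $x$ of $F$ by an independent set $V_x$ (of some positive size, sizes may differ) and each edge $xy$ of $F$ by a complete bipartite graph between $V_x$ and $V_y$, with no other edges. A graph $F$ is maximal $K_r$-free if it is $K_r$-free and adding any new edge creates a copy of $K_r$. Logarithms are natural.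
   Formalization: The bound uses log(max(1/ε, 2)) in place of log(1/ε), which is the same for ε ≤ 1/2; the literal bound fails for larger ε, e.g. r = 3, G = K_2, ε = 1, where F must have 2 vertices but the bound is 2^0 = 1. -}

module Defs where

open import Level using (0ℓ)
open import Data.Nat.Base using (ℕ; zero; suc)
import Data.Nat.Properties as ℕₚ
open import Data.Integer.Base using (+_)
open import Data.Rational.Base
  using (ℚ; 0ℚ; 1ℚ; _/_; _+_; _-_; _*_; _≤_; _<_; +-*-rawSemiring)
open import Algebra.Definitions.RawSemiring +-*-rawSemiring using (_^_)
open import Data.Fin.Base using (Fin)
import Data.Fin.Properties as Fin
open import Data.Fin.Subset using (Subset; inside; outside; _∈_; _⊆_; _∩_; ∣_∣)
open import Data.Fin.Subset.Properties using (_∈?_; _⊆?_)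
open import Data.Vec.Base using ([]; _∷_; tabulate)
open import Data.List.Base using (List; [_]; _++_; map; filter; length)
open import Data.Product.Base using (∃; ∃-syntax; _×_; _,_)
open import Data.Sum.Base using (_⊎_; inj₁; inj₂)
open import Relation.Nullary using (¬_; Dec; does)
open import Relation.Nullary.Decidable using (_×-dec_; _⊎-dec_; _→-dec_; ¬?)
open import Relation.Unary using (Pred)
open import Relation.Binary.Core using (Rel)
open import Relation.Binary.Definitions using (Symmetric; Decidable)
open import Relation.Binary.PropositionalEquality using (_≡_; _≢_; sym; trans)

------------------------------------------------------------------------
-- Graphs

-- Finite simple graphs with vertex set Fin n.
record Graph (n : ℕ) : Set₁ where
  field
    _∼_     : Rel (Fin n) 0ℓ
    _∼?_    : Decidable _∼_
    ∼-sym   : Symmetric _∼_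
    ∼-irrefl : ∀ {x} → ¬ (x ∼ x)

open Graph public using () renaming (_∼_ to Adj)

N : ∀ {n} → Graph n → Fin n → Subset n
N G u = tabulate (λ v → does (u ∼? v))
  where open Graph G

IsClique : ∀ {n} → Graph n → Subset n → Set
IsClique G S = ∀ x → x ∈ S → ∀ y → y ∈ S → x ≢ y → Adj G x y

isClique? : ∀ {n} (G : Graph n) (S : Subset n) → Dec (IsClique G S)
isClique? G S =
  Fin.all? λ x → (x ∈? S) →-dec
  Fin.all? λ y → (y ∈? S) →-dec
  (¬? (x Fin.≟ y) →-dec (x ∼? y))
  where open Graph G

-- S is the vertex set of a copy of K_k in the induced subgraph G[W].
-- A copy of K_k is determined by its vertex set, so copies are unlabelled.
IsCopyIn : ∀ {n} → ℕ → Graph n → Subset n → Subset n → Set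
IsCopyIn k G W S = S ⊆ W × ∣ S ∣ ≡ k × IsClique G S

isCopyIn? : ∀ {n} k (G : Graph n) (W S : Subset n) → Dec (IsCopyIn k G W S)
isCopyIn? k G W S = (S ⊆? W) ×-dec (∣ S ∣ ℕₚ.≟ k) ×-dec isClique? G S

-- Every subset of Fin n, each listed exactly once.
subsets : ∀ n → List (Subset n)
subsets zero    = [ [] ]
subsets (suc n) = map (inside ∷_) (subsets n) ++ map (outside ∷_) (subsets n)

#copies : ∀ {n} → ℕ → Graph n → Subset n → ℕ
#copies {n} k G W = length (filter (isCopyIn? k G W) (subsets n))

ContainsK : ∀ {n} → ℕ → Graph n → Set
ContainsK r G = ∃[ S ] ∣ S ∣ ≡ r × IsClique G S

KFree : ∀ {n} → ℕ → Graph n → Set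
KFree r G = ¬ ContainsK r G

addEdge : ∀ {n} (G : Graph n) (a b : Fin n) → a ≢ b → Graph n
addEdge G a b a≢b = record
  { _∼_      = λ x y → x ∼ y ⊎ (x ≡ a × y ≡ b) ⊎ (x ≡ b × y ≡ a)
  ; _∼?_     = λ x y → (x ∼? y) ⊎-dec
                       ((x Fin.≟ a) ×-dec (y Fin.≟ b)) ⊎-dec
                       ((x Fin.≟ b) ×-dec (y Fin.≟ a))
  ; ∼-sym    = λ { (inj₁ e)               → inj₁ (∼-sym e)
                 ; (inj₂ (inj₁ (p , q))) → inj₂ (inj₂ (q , p))
                 ; (inj₂ (inj₂ (p , q))) → inj₂ (inj₁ (q , p)) }
  ; ∼-irrefl = λ { (inj₁ e)               → ∼-irrefl e
                 ; (inj₂ (inj₁ (p , q))) → a≢b (trans (sym p) q)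
                 ; (inj₂ (inj₂ (p , q))) → a≢b (trans (sym q) p) }
  }
  where open Graph G

record MaximalKFree {n} (r : ℕ) (F : Graph n) : Set where
  field
    free    : KFree r F
    maximal : ∀ a b (a≢b : a ≢ b) → ¬ Adj F a b →
              ContainsK r (addEdge F a b a≢b)

-- G = F[·]: the set V_x replacing the vertex x of F is the fibre of
-- `part` over x.
record _IsBlowUpOf_ {n m} (G : Graph n) (F : Graph m) : Set where
  field
    part        : Fin n → Fin m
    nonempty    : ∀ x → ∃[ u ] part u ≡ x
    independent : ∀ u v → part u ≡ part v → ¬ Adj G u v
    complete    : ∀ u v → Adj F (part u) (part v) → Adj G u v
    no-others   : ∀ u v → Adj G u v → Adj F (part u) (part v)

------------------------------------------------------------------------
-- Real numbers

-- Dedekind cuts: L q means q < x, and U q means x < q.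
record ℝ : Set₁ where
  field
    L U      : Pred ℚ 0ℓ
    L-inhab  : ∃[ q ] L q
    U-inhab  : ∃[ q ] U q
    L-down   : ∀ {p q} → p < q → L q → L p
    U-up     : ∀ {p q} → p < q → U p → U q
    L-open   : ∀ {p} → L p → ∃[ q ] p < q × L q
    U-open   : ∀ {q} → U q → ∃[ p ] p < q × U p
    disjoint : ∀ {q} → ¬ (L q × U q)
    located  : ∀ {p q} → p < q → L p ⊎ U q

fromℕ : ℕ → ℚ
fromℕ m = + m / 1

Positive : ℝ → Set
Positive x = ℝ.L x 0ℚ

-- x · m ≤ c.
_·_≤ⁿ_ : ℝ → ℕ → ℕ → Set
x · m ≤ⁿ c = ∀ q → ℝ.L x q → q * fromℕ m ≤ fromℕ c

------------------------------------------------------------------------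
-- The vertex bound
--
-- The bound is only ever compared from below with a natural number, so it
-- suffices to know the rationals strictly below it.  A value x is given by
-- its lower cut { q | q < x }.  The operations are built from functions
-- that are increasing in each cut; inv takes a Dedekind real, since
-- 1/x decreases in x.

Cut : Set₁
Cut = Pred ℚ 0ℓ

nat : ℕ → Cut
nat m q = q < fromℕ m

_+ᶜ_ : Cut → Cut → Cut
(A +ᶜ B) q = ∃[ a ] ∃[ b ] A a × B b × q ≤ a + b

-- Product of positive reals.
_*ᶜ_ : Cut → Cut → Cut
(A *ᶜ B) q = ∃[ a ] ∃[ b ] A a × B b × 0ℚ < a × 0ℚ < b × q ≤ a * b

_⊔ᶜ_ : Cut → Cut → Cut
(A ⊔ᶜ B) q = A q ⊎ B q

-- 1/x for x > 0: every u with x < u is positive, and q ≤ 1/u < 1/x.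
inv : ℝ → Cut
inv x q = ∃[ u ] ℝ.U x u × q * u ≤ 1ℚ

-- The natural logarithm of x > 0.  For t < 1, e^(kt) ≤ (1 - t)^(-k), and
-- (1 - s/k)^(-k) decreases to e^s as k → ∞ (k > s).  Hence e^s < x iff
-- (1 - t)^(-k) ≤ y < x for some rational y and some k, t with s = kt.
ln : Cut → Cut
ln A q = ∃[ y ] ∃[ k ] ∃[ t ]
  A y × t < 1ℚ × 1ℚ ≤ y * (1ℚ - t) ^ k × q ≤ fromℕ k * t

-- 2^x for x > 0: the rationals q ≤ z ≤ 2^(a/b) with a/b < x, where b = suc b′
-- and z ≤ 2^(a/b) is written z^b ≤ 2^a.
2^ᶜ_ : Cut → Cut
(2^ᶜ A) q = ∃[ a ] ∃[ b′ ] ∃[ z ]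
  A (+ a / suc b′) × 0ℚ ≤ z × z ^ suc b′ ≤ fromℕ 2 ^ a × q ≤ z

_≤ᶜ_ : ℕ → Cut → Set
m ≤ᶜ A = ∀ q → q < fromℕ m → A q

infixl 6 _+ᶜ_ _⊔ᶜ_
infixl 7 _*ᶜ_
infix  8 2^ᶜ_
infix  4 _≤ᶜ_ _·_≤ⁿ_ _IsBlowUpOf_

-- 2^(C (1/ε + r) log(max(1/ε, 2))).  For ε ≤ 1/2 the maximum is 1/ε.  Some
-- such convention is needed for larger ε: the complete graphs K_n, 2 ≤ n < r,
-- have no non-adjacent pairs and are blow-ups only of themselves, whereas
-- 2^(C (1/ε + r) log(1/ε)) tends to 1 as ε → 1 and is at most 1 for ε ≥ 1.
vertexBound : ℕ → ℕ → ℝ → Cut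
vertexBound C r ε = 2^ᶜ (nat C *ᶜ ((inv ε +ᶜ nat r) *ᶜ ln (inv ε ⊔ᶜ nat 2)))

{-# OPTIONS --safe #-}

-- F is the quotient of G by the twin relation (equal neighbourhoods), so the
-- point is to bound a list L of pairwise non-twin vertices.  Let K ≥ 1/ε and
-- d = r - 2.  If z and u are distinct, non-adjacent and not twins, then
-- N(u) \ N(z) has at least n/K elements: for w in N(z) \ N(u), each of the at
-- least n^d/K copies of K_d in N(u) ∩ N(w) meets N(u) \ N(z), as otherwise it
-- would form a K_r with z and w.  Fix z in L and count pairs (u , x) with u in L
-- not adjacent to z and x in N(u) \ N(z): for some x, L ∩ N(x) contains a
-- fraction 1/K of these u.  Passing from L to L ∩ N(x) lowers by n^d/K the number
-- of d-cliques lying in N(v) for some v in L: those in N(x) ∩ N(z) are lost, since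
-- v ~ x would complete them to a K_r.  Hence this happens at most K times.  The
-- other vertices of L, apart from z, form L ∩ N(z), whose clique number is
-- smaller, which happens fewer than r times.  Each step costs a factor of at most
-- 2K, whence |L| ≤ (2K)^(K + r).
module Submission where

open import Defs
open import Level using (Level; 0ℓ)
open import Algebra.Properties.CommutativeSemigroup using (interchange; x∙yz≈y∙xz)
open import Data.Bool.Base using (true; false)
open import Data.Fin.Base using (Fin; zero; suc)
import Data.Fin.Properties as Fin
open import Data.Fin.Subset
  using (Subset; inside; outside; _∈_; _∉_; _∩_; ∣_∣; ⊥; Nonempty)
open import Data.Fin.Subset.Properties
  using (_∈?_; x∈p∩q⁺; x∈p∩q⁻; x∈p⇒∣p-x∣<∣p∣; ∣⊥∣≡0; ∉⊥; drop-there; drop-not-there)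
open import Data.List.Base
  using (List; []; _∷_; _++_; map; filter; length; allFin; lookup; deduplicate)
import Data.List.Properties as List
open import Data.List.Membership.Propositional using (find) renaming (_∈_ to _∈ᴸ_)
open import Data.List.Membership.Propositional.Properties using (∈-filter⁻; ∈-allFin; ∈-lookup)
open import Data.List.Relation.Unary.All as All using (All; []; _∷_)
import Data.List.Relation.Unary.All.Properties as All
open import Data.List.Relation.Unary.AllPairs as AllPairs using (AllPairs; []; _∷_)
import Data.List.Relation.Unary.AllPairs.Properties as AllPairs
open import Data.List.Relation.Unary.Any as Any using (Any; here; there; any?)
import Data.List.Relation.Unary.Any.Properties as Any
open import Data.List.Relation.Unary.Unique.DecSetoid.Properties using (deduplicate-!)
open import Data.List.Relation.Unary.Unique.Propositional using (Unique)
open import Data.List.Relation.Unary.Unique.Propositional.Properties using (allFin⁺; filter⁺)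
open import Data.Nat.ListAction using (sum)
open import Data.Product.Base using (∃; ∃-syntax; _×_; _,_; proj₁; proj₂)
open import Data.Sum.Base using (_⊎_; inj₁; inj₂; [_,_]′)
open import Data.Vec.Base using ([]; _∷_; here; there; _[_]≔_)
import Data.Vec.Base as Vec
import Data.Vec.Properties as Vec
open import Function.Base using (_∘_; id; flip)
open import Relation.Binary.Bundles using (DecSetoid)
open import Relation.Binary.Definitions as Rel using (Symmetric)
open import Relation.Binary.PropositionalEquality
open import Relation.Nullary using (¬_; Dec; yes; no; does; contradiction)
open import Relation.Nullary.Decidable
  using (¬?; _×-dec_; _→-dec_; decidable-stable; dec-true; toWitness)
open import Relation.Unary using (Pred; Decidable)

-- Rational arithmetic.

module VertexBound where

  open import Algebra.Bundles using (CommutativeMonoid)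
  open import Data.Integer.Base as ℤ using (+_; +[1+_])
  import Data.Integer.Properties as ℤ
  open import Data.Nat.Base as ℕ using (ℕ; zero; suc; z≤n; s≤s)
  import Data.Nat.Properties as ℕ
  open import Data.Rational.Base hiding (Positive)
  open import Data.Rational.Properties
  import Data.Rational.Unnormalised.Base as ℚᵘ
  import Data.Rational.Unnormalised.Properties as ℚᵘ
  open import Algebra.Definitions.RawSemiring +-*-rawSemiring using (_^_)

  private
    ℚ-* = CommutativeMonoid.commutativeSemigroup *-1-commutativeMonoid

    ι : ℕ → ℚᵘ.ℚᵘ
    ι m = ℚᵘ.mkℚᵘ (+ m) 0

    toℚᵘ-fromℕ : ∀ m → toℚᵘ (fromℕ m) ℚᵘ.≃ ι m
    toℚᵘ-fromℕ m = toℚᵘ-fromℚᵘ (ι m)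

  fromℕ-mono-≤ : ∀ {m n} → m ℕ.≤ n → fromℕ m ≤ fromℕ n
  fromℕ-mono-≤ {m} {n} m≤n = toℚᵘ-cancel-≤
    (ℚᵘ.≤-respˡ-≃ (ℚᵘ.≃-sym (toℚᵘ-fromℕ m)) (ℚᵘ.≤-respʳ-≃ (ℚᵘ.≃-sym (toℚᵘ-fromℕ n))
      (ℚᵘ.*≤* (ℤ.*-monoʳ-≤-nonNeg (+ 1) (ℤ.+≤+ m≤n)))))

  fromℕ-cancel-≤ : ∀ {m n} → fromℕ m ≤ fromℕ n → m ℕ.≤ n
  fromℕ-cancel-≤ {m} {n} m≤n
    with ℚᵘ.*≤* le ← ℚᵘ.≤-respˡ-≃ (toℚᵘ-fromℕ m) (ℚᵘ.≤-respʳ-≃ (toℚᵘ-fromℕ n) (toℚᵘ-mono-≤ m≤n)) =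
    ℤ.drop‿+≤+ (subst₂ ℤ._≤_ (ℤ.*-identityʳ (+ m)) (ℤ.*-identityʳ (+ n)) le)

  fromℕ-mono-< : ∀ {m n} → m ℕ.< n → fromℕ m < fromℕ n
  fromℕ-mono-< {m} {n} m<n = ≰⇒> λ n≤m → ℕ.<⇒≱ m<n (fromℕ-cancel-≤ n≤m)

  fromℕ-* : ∀ m n → fromℕ (m ℕ.* n) ≡ fromℕ m * fromℕ n
  fromℕ-* m n = toℚᵘ-injective (begin
    toℚᵘ (fromℕ (m ℕ.* n))               ≈⟨ toℚᵘ-fromℕ (m ℕ.* n) ⟩
    ι (m ℕ.* n)                          ≈⟨ ℚᵘ.*≡* (cong (ℤ._* + 1) (ℤ.pos-* m n)) ⟩
    ι m ℚᵘ.* ι n                         ≈⟨ ℚᵘ.*-cong (toℚᵘ-fromℕ m) (toℚᵘ-fromℕ n) ⟨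
    toℚᵘ (fromℕ m) ℚᵘ.* toℚᵘ (fromℕ n)   ≈⟨ toℚᵘ-homo-* (fromℕ m) (fromℕ n) ⟨
    toℚᵘ (fromℕ m * fromℕ n)             ∎)
    where open import Relation.Binary.Reasoning.Setoid ℚᵘ.≃-setoid

  fromℕ-+ : ∀ m n → fromℕ (m ℕ.+ n) ≡ fromℕ m + fromℕ n
  fromℕ-+ m n = toℚᵘ-injective (begin
    toℚᵘ (fromℕ (m ℕ.+ n))               ≈⟨ toℚᵘ-fromℕ (m ℕ.+ n) ⟩
    ι (m ℕ.+ n)                          ≈⟨ ℚᵘ.*≡* (cong (ℤ._* + 1) (trans (ℤ.pos-+ m n)
                                              (sym (cong₂ ℤ._+_ (ℤ.*-identityʳ (+ m)) (ℤ.*-identityʳ (+ n)))))) ⟩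
    ι m ℚᵘ.+ ι n                         ≈⟨ ℚᵘ.+-cong (toℚᵘ-fromℕ m) (toℚᵘ-fromℕ n) ⟨
    toℚᵘ (fromℕ m) ℚᵘ.+ toℚᵘ (fromℕ n)   ≈⟨ toℚᵘ-homo-+ (fromℕ m) (fromℕ n) ⟨
    toℚᵘ (fromℕ m + fromℕ n)             ∎)
    where open import Relation.Binary.Reasoning.Setoid ℚᵘ.≃-setoid

  fromℕ-^ : ∀ m k → fromℕ (m ℕ.^ k) ≡ fromℕ m ^ k
  fromℕ-^ m zero    = refl
  fromℕ-^ m (suc k) = trans (fromℕ-* m (m ℕ.^ k)) (cong (fromℕ m *_) (fromℕ-^ m k))

  fromℕ-nonNeg : ∀ m → NonNegative (fromℕ m)
  fromℕ-nonNeg m = nonNegative (fromℕ-mono-≤ {0} {m} z≤n)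

  2^k*½^k≡1 : ∀ k → fromℕ (2 ℕ.^ k) * ½ ^ k ≡ 1ℚ
  2^k*½^k≡1 zero    = refl
  2^k*½^k≡1 (suc k) = begin
    fromℕ (2 ℕ.* 2 ℕ.^ k) * (½ * ½ ^ k)          ≡⟨ cong (_* (½ * ½ ^ k)) (fromℕ-* 2 (2 ℕ.^ k)) ⟩
    fromℕ 2 * fromℕ (2 ℕ.^ k) * (½ * ½ ^ k)      ≡⟨ interchange ℚ-* (fromℕ 2) (fromℕ (2 ℕ.^ k)) ½ (½ ^ k) ⟩
    fromℕ 2 * ½ * (fromℕ (2 ℕ.^ k) * ½ ^ k)      ≡⟨ cong (fromℕ 2 * ½ *_) (2^k*½^k≡1 k) ⟩
    1ℚ                                           ∎
    where open ≡-Reasoning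

  ½^k>0 : ∀ k → 0ℚ < ½ ^ k
  ½^k>0 zero    = toWitness {a? = 0ℚ <? 1ℚ} _
  ½^k>0 (suc k) = *-monoʳ-<-pos ½ (½^k>0 k)

  ½^1+k<½^k : ∀ k → ½ ^ suc k < ½ ^ k
  ½^1+k<½^k k = subst (½ * ½ ^ k <_) (*-identityˡ (½ ^ k))
    (*-monoˡ-<-pos (½ ^ k) {{positive (½^k>0 k)}} (toWitness {a? = ½ <? 1ℚ} _))

  n<2^n : ∀ n → n ℕ.< 2 ℕ.^ n
  n<2^n zero    = ℕ.≤-refl
  n<2^n (suc n) = ℕ.≤-trans (ℕ.+-mono-≤ (ℕ.m^n>0 2 n) (n<2^n n))
    (ℕ.≤-reflexive (cong (2 ℕ.^ n ℕ.+_) (sym (ℕ.+-identityʳ _))))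

  -- For p = (m + 1)/(d + 1) the exponent d + 1 works, as 2^(d + 1) p > (d + 1) p ≥ 1.
  ½^k-small : ∀ p → 0ℚ < p → ∃[ k ] ½ ^ k < p
  ½^k-small p@(mkℚ +[1+ m ] d _) _ = suc d ,
    *-cancelˡ-<-nonNeg (fromℕ (2 ℕ.^ suc d)) {{fromℕ-nonNeg (2 ℕ.^ suc d)}} (begin-strict
    fromℕ (2 ℕ.^ suc d) * ½ ^ suc d    ≡⟨ 2^k*½^k≡1 (suc d) ⟩
    1ℚ                                 ≤⟨ 1≤dp ⟩
    fromℕ (suc d) * p                  <⟨ *-monoˡ-<-pos p (fromℕ-mono-< (n<2^n (suc d))) ⟩
    fromℕ (2 ℕ.^ suc d) * p            ∎)
    where
    open ≤-Reasoning
    1≤dp : 1ℚ ≤ fromℕ (suc d) * p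
    1≤dp = toℚᵘ-cancel-≤ (ℚᵘ.≤-respʳ-≃
      (ℚᵘ.≃-sym (ℚᵘ.≃-trans (toℚᵘ-homo-* (fromℕ (suc d)) p) (ℚᵘ.*-congʳ (toℚᵘ-fromℕ (suc d)))))
      (ℚᵘ.*≤* (ℤ.+≤+ (ℕ.≤-trans
        (ℕ.≤-reflexive (trans (ℕ.*-identityˡ _) (trans (ℕ.*-identityˡ (suc d)) (sym (ℕ.*-identityʳ (suc d))))))
        (ℕ.≤-trans (ℕ.*-monoʳ-≤ (suc d) (s≤s z≤n)) (ℕ.≤-reflexive (sym (ℕ.*-identityʳ (suc d ℕ.* suc m)))))))))
  ½^k-small (mkℚ (+ 0) _ _) (*<* (ℤ.+<+ ()))
  ½^k-small (mkℚ (ℤ.-[1+ _ ]) _ _) (*<* ())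

  -- Dyadic approximation of ε and comparison with the vertex bound.

  module _ (ε : ℝ) where
    open ℝ ε

    -- Locatedness only decides between overlapping alternatives, so ε is
    -- pinned down to within a factor of 4.
    dyadic-approx : Positive ε → ∃[ j ] L (½ ^ (2 ℕ.+ j)) × (j ≡ 0 ⊎ U (½ ^ j))
    dyadic-approx ε>0 with p , 0<p , Lp ← L-open ε>0 with k , ½^k<p ← ½^k-small p 0<p =
      descend k (L-down ½^k<p Lp)
      where
      descend : ∀ k → L (½ ^ k) → ∃[ j ] L (½ ^ (2 ℕ.+ j)) × (j ≡ 0 ⊎ U (½ ^ j))
      -- With the default j = 0 no upper bound on ε comes along; the 2 in `inv ε ⊔ᶜ nat 2` then has
      -- to supply the logarithm.
      descend 0 Lk = 0 , L-down (toWitness {a? = ½ ^ 2 <? ½ ^ 0} _) Lk , inj₁ refl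
      descend 1 Lk = 0 , L-down (½^1+k<½^k 1) Lk , inj₁ refl
      descend 2 Lk = 0 , Lk , inj₁ refl
      descend (suc (suc (suc j))) Lk =
        [ descend (suc (suc j)) , (λ U′ → suc j , Lk , inj₂ U′) ]′ (located (½^1+k<½^k (suc j)))

    -- The rational 1/2^k below ε may stand in for ε, and multiplying by 2^k clears the denominator.
    -- This turns the density hypothesis into one about natural numbers.
    ·≤ⁿ⇒≤ : ∀ k {m c} → L (½ ^ k) → ε · m ≤ⁿ c → m ℕ.≤ 2 ℕ.^ k ℕ.* c
    ·≤ⁿ⇒≤ k {m} {c} Lk εm≤c = fromℕ-cancel-≤ (begin
      fromℕ m                                   ≡⟨ *-identityˡ (fromℕ m) ⟨
      1ℚ * fromℕ m                              ≡⟨ cong (_* fromℕ m) (2^k*½^k≡1 k) ⟨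
      fromℕ (2 ℕ.^ k) * ½ ^ k * fromℕ m         ≡⟨ *-assoc (fromℕ (2 ℕ.^ k)) (½ ^ k) (fromℕ m) ⟩
      fromℕ (2 ℕ.^ k) * (½ ^ k * fromℕ m)       ≤⟨ *-monoˡ-≤-nonNeg (fromℕ (2 ℕ.^ k)) {{fromℕ-nonNeg (2 ℕ.^ k)}} (εm≤c (½ ^ k) Lk) ⟩
      fromℕ (2 ℕ.^ k) * fromℕ c                 ≡⟨ fromℕ-* (2 ℕ.^ k) c ⟨
      fromℕ (2 ℕ.^ k ℕ.* c)                     ∎)
      where open ≤-Reasoning

    -- Here c, s and l are witnesses below C, 1/ε + r and the logarithm, and the exponent of 2 is
    -- the integer a. As `nat C` consists of the rationals strictly below C, c < C must be strict.
    ≤ᶜvertexBound : ∀ {C c r m a s l} → c ℕ.< C → 0 ℕ.< c → m ℕ.≤ 2 ℕ.^ a →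
      (inv ε +ᶜ nat r) (fromℕ s) → 0 ℕ.< s → ln (inv ε ⊔ᶜ nat 2) l → 0ℚ < l →
      fromℕ a ≤ fromℕ c * (fromℕ s * l) → m ≤ᶜ vertexBound C r ε
    ≤ᶜvertexBound {c = c} {m = m} {a} {s} {l} c<C 0<c m≤2^a s∈ 0<s l∈ 0<l a≤ q q<m =
      a , 0 , fromℕ m
      , (fromℕ c , fromℕ s * l , fromℕ-mono-< c<C
        , (fromℕ s , l , s∈ , l∈ , 0<fs , 0<l , ≤-refl)
        , fromℕ-mono-< 0<c
        , positive⁻¹ _ {{pos*pos⇒pos (fromℕ s) {{positive 0<fs}} l {{positive 0<l}}}}
        , a≤)
      , fromℕ-mono-≤ {0} {m} z≤n
      , subst₂ _≤_ (sym (*-identityʳ (fromℕ m))) (fromℕ-^ 2 a) (fromℕ-mono-≤ m≤2^a)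
      , <⇒≤ q<m
      where 0<fs = fromℕ-mono-< 0<s

    -- Uses r - 1 < 1/ε + r and 1/3 < log 2.
    bound-large-ε : ∀ {k m} → m ℕ.≤ (2 ℕ.* 4) ℕ.^ (4 ℕ.+ (3 ℕ.+ k)) →
      m ≤ᶜ vertexBound 34 (3 ℕ.+ k) ε
    bound-large-ε {k} {m} m≤ = ≤ᶜvertexBound
      -- The base 2 · 4 is 2^3, which gives a. Since 3 (7 + k) ≤ 11 (2 + k) and 11 = 33 · 1/3, c =
      -- 33 is enough, whence C = 34.
      {C = 34} {c = 33} {r = 3 ℕ.+ k} {a = 3 ℕ.* (7 ℕ.+ k)} {s = 2 ℕ.+ k} {l = ⅓}
      ℕ.≤-refl (s≤s z≤n)
      (ℕ.≤-trans m≤ (ℕ.≤-reflexive (ℕ.^-*-assoc 2 3 (7 ℕ.+ k))))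
      (0ℚ , fromℕ (2 ℕ.+ k) , inv∋0
        , fromℕ-mono-< {2 ℕ.+ k} {3 ℕ.+ k} ℕ.≤-refl , ≤-reflexive (sym (+-identityˡ _)))
      (s≤s z≤n)
      -- 1/3 < log 2 because (3/2)(1 - 1/3) = 1 and 3/2 < 2.
      (+ 3 / 2 , 1 , ⅓ , inj₂ (toWitness {a? = + 3 / 2 <? fromℕ 2} _)
        , toWitness {a? = ⅓ <? 1ℚ} _
        , toWitness {a? = 1ℚ ≤? + 3 / 2 * (1ℚ - ⅓) ^ 1} _
        , toWitness {a? = ⅓ ≤? fromℕ 1 * ⅓} _)
      (toWitness {a? = 0ℚ <? ⅓} _)
      (begin
        fromℕ (3 ℕ.* (7 ℕ.+ k))            ≤⟨ fromℕ-mono-≤ 3*7+k≤ ⟩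
        fromℕ (11 ℕ.* (2 ℕ.+ k))           ≡⟨ fromℕ-* 11 (2 ℕ.+ k) ⟩
        fromℕ 11 * fromℕ (2 ℕ.+ k)         ≡⟨ *-comm (fromℕ 11) (fromℕ (2 ℕ.+ k)) ⟩
        fromℕ (2 ℕ.+ k) * (fromℕ 33 * ⅓)   ≡⟨ x∙yz≈y∙xz ℚ-* (fromℕ (2 ℕ.+ k)) (fromℕ 33) ⅓ ⟩
        fromℕ 33 * (fromℕ (2 ℕ.+ k) * ⅓)   ∎)
      where
      open ≤-Reasoning
      ⅓ = + 1 / 3
      inv∋0 : inv ε 0ℚ
      inv∋0 = let u , Uu = U-inhab in
        u , Uu , ≤-trans (≤-reflexive (*-zeroˡ u)) (toWitness {a? = 0ℚ ≤? 1ℚ} _)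
      3*7+k≤ : 3 ℕ.* (7 ℕ.+ k) ℕ.≤ 11 ℕ.* (2 ℕ.+ k)
      3*7+k≤ = subst₂ ℕ._≤_ (sym (ℕ.*-distribˡ-+ 3 7 k)) (sym (ℕ.*-distribˡ-+ 11 2 k))
        (ℕ.+-mono-≤ (ℕ.n≤1+n 21) (ℕ.*-monoˡ-≤ k (ℕ.m≤m+n 3 8)))

    -- Uses 2^(j + 1) + (r - 1) < 1/ε + r and (j + 1)/2 < log 2^(j + 1) < log (1/ε).
    bound-small-ε : ∀ {j k m} → U (½ ^ suc j) →
      m ℕ.≤ (2 ℕ.* 2 ℕ.^ (3 ℕ.+ j)) ℕ.^ (2 ℕ.^ (3 ℕ.+ j) ℕ.+ (3 ℕ.+ k)) →
      m ≤ᶜ vertexBound 34 (3 ℕ.+ k) ε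
    bound-small-ε {j} {k} {m} Uj m≤ = ≤ᶜvertexBound
      -- The base is 2^(4 + j). From 4 + j ≤ 4 (j + 1) and 2^(3 + j) + 3 + k ≤ 4 s comes e ≤ 16 s (j
      -- + 1) = 32 s l.
      {C = 34} {c = 32} {r = 3 ℕ.+ k} {a = e} {s = s} {l = l}
      (ℕ.n≤1+n 33) (s≤s z≤n)
      (ℕ.≤-trans m≤ (ℕ.≤-reflexive (ℕ.^-*-assoc 2 (4 ℕ.+ j) (2 ℕ.^ (3 ℕ.+ j) ℕ.+ (3 ℕ.+ k)))))
      (fromℕ (2 ℕ.^ suc j) , fromℕ (2 ℕ.+ k) , inv∋ , fromℕ-mono-< {2 ℕ.+ k} {3 ℕ.+ k} ℕ.≤-refl
        , ≤-reflexive (fromℕ-+ (2 ℕ.^ suc j) (2 ℕ.+ k)))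
      (ℕ.≤-trans (ℕ.m^n>0 2 (suc j)) (ℕ.m≤m+n _ _))
      -- With t = 1/2 and j + 1 factors the condition on y reads y ≥ 2^(j + 1), and 2^(j + 1) itself
      -- lies below 1/ε.
      (fromℕ (2 ℕ.^ suc j) , suc j , ½ , inj₁ inv∋ , toWitness {a? = ½ <? 1ℚ} _
        , ≤-reflexive (sym (2^k*½^k≡1 (suc j))) , ≤-refl)
      (*-monoˡ-<-pos ½ (fromℕ-mono-< {0} {suc j} (s≤s z≤n)))
      (begin
        fromℕ e                                    ≤⟨ fromℕ-mono-≤ e≤ ⟩
        fromℕ (16 ℕ.* (s ℕ.* suc j))               ≡⟨ fromℕ-* 16 (s ℕ.* suc j) ⟩
        fromℕ 16 * fromℕ (s ℕ.* suc j)             ≡⟨ cong (fromℕ 16 *_) (fromℕ-* s (suc j)) ⟩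
        fromℕ 32 * ½ * (fromℕ s * fromℕ (suc j))   ≡⟨ *-assoc (fromℕ 32) ½ (fromℕ s * fromℕ (suc j)) ⟩
        fromℕ 32 * (½ * (fromℕ s * fromℕ (suc j))) ≡⟨ cong (fromℕ 32 *_) (x∙yz≈y∙xz ℚ-* ½ (fromℕ s) (fromℕ (suc j))) ⟩
        fromℕ 32 * (fromℕ s * (½ * fromℕ (suc j))) ≡⟨ cong (λ x → fromℕ 32 * (fromℕ s * x)) (*-comm ½ (fromℕ (suc j))) ⟩
        fromℕ 32 * (fromℕ s * l)                   ∎)
      where
      open ≤-Reasoning
      e = (4 ℕ.+ j) ℕ.* (2 ℕ.^ (3 ℕ.+ j) ℕ.+ (3 ℕ.+ k))
      s = 2 ℕ.^ suc j ℕ.+ (2 ℕ.+ k)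
      l = fromℕ (suc j) * ½
      inv∋ : inv ε (fromℕ (2 ℕ.^ suc j))
      inv∋ = ½ ^ suc j , Uj , ≤-reflexive (2^k*½^k≡1 (suc j))
      4+j≤ : 4 ℕ.+ j ℕ.≤ 4 ℕ.* suc j
      4+j≤ = subst (4 ℕ.+ j ℕ.≤_) (sym (ℕ.*-suc 4 j)) (ℕ.+-monoʳ-≤ 4 (ℕ.m≤n*m j 4))
      4s≥ : 2 ℕ.^ (3 ℕ.+ j) ℕ.+ (3 ℕ.+ k) ℕ.≤ 4 ℕ.* s
      4s≥ = subst (2 ℕ.^ (3 ℕ.+ j) ℕ.+ (3 ℕ.+ k) ℕ.≤_) (sym (ℕ.*-distribˡ-+ 4 (2 ℕ.^ suc j) (2 ℕ.+ k)))
        (ℕ.+-mono-≤ (ℕ.≤-reflexive (sym (ℕ.*-assoc 2 2 (2 ℕ.^ suc j))))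
          (subst (3 ℕ.+ k ℕ.≤_) (sym (ℕ.*-distribˡ-+ 4 2 k)) (ℕ.+-mono-≤ (ℕ.m≤m+n 3 5) (ℕ.m≤n*m k 4))))
      e≤ : e ℕ.≤ 16 ℕ.* (s ℕ.* suc j)
      e≤ = ℕ.≤-trans (ℕ.*-mono-≤ 4+j≤ 4s≥) (ℕ.≤-reflexive
        (trans (interchange ℕ.*-commutativeSemigroup 4 (suc j) 4 s) (cong (16 ℕ.*_) (ℕ.*-comm (suc j) s))))

    bound-dyadic : ∀ {j k m} → j ≡ 0 ⊎ U (½ ^ j) →
      m ℕ.≤ (2 ℕ.* 2 ℕ.^ (2 ℕ.+ j)) ℕ.^ (2 ℕ.^ (2 ℕ.+ j) ℕ.+ (3 ℕ.+ k)) →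
      m ≤ᶜ vertexBound 34 (3 ℕ.+ k) ε
    bound-dyadic {zero}  {k} _         m≤ = bound-large-ε {k} m≤
    bound-dyadic {suc j} {k} (inj₂ Uj) m≤ = bound-small-ε {j} {k} Uj m≤

open VertexBound

open import Data.Nat.Base
open import Data.Nat.Properties

-- Counting in lists and double counting.

private
  variable
    a p : Level
    A B : Set a

count : {P : Pred A p} → Decidable P → List A → ℕ
count P? xs = length (filter P? xs)

module _ {A : Set a} {P : Pred A p} (P? : Decidable P) where

  count-++ : ∀ xs ys → count P? (xs ++ ys) ≡ count P? xs + count P? ys
  count-++ xs ys = trans (cong length (List.filter-++ P? xs ys)) (List.length-++ (filter P? xs))

  count-map : (f : B → A) → ∀ xs → count P? (map f xs) ≡ count (P? ∘ f) xs
  count-map f []       = refl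
  count-map f (x ∷ xs) with does (P? (f x))
  ... | true  = cong suc (count-map f xs)
  ... | false = count-map f xs

  count-none : (∀ {x} → ¬ P x) → ∀ xs → count P? xs ≡ 0
  count-none none []       = refl
  count-none none (x ∷ xs) with P? x
  ... | yes px = contradiction px none
  ... | no  _  = count-none none xs

  length≡count+count¬ : ∀ xs → length xs ≡ count P? xs + count (¬? ∘ P?) xs
  length≡count+count¬ []       = refl
  length≡count+count¬ (x ∷ xs) with P? x
  ... | yes _ = cong suc (length≡count+count¬ xs)
  ... | no  _ = trans (cong suc (length≡count+count¬ xs)) (sym (+-suc _ _))

count-disjoint : {P Q R : Pred A p} (P? : Decidable P) (Q? : Decidable Q) (R? : Decidable R) →
                 (∀ {x} → P x → R x) → (∀ {x} → Q x → R x) → (∀ {x} → P x → ¬ Q x) →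
                 ∀ xs → count P? xs + count Q? xs ≤ count R? xs
count-disjoint P? Q? R? P⊆R Q⊆R P∩Q []       = z≤n
count-disjoint P? Q? R? P⊆R Q⊆R P∩Q (x ∷ xs)
  with ih ← count-disjoint P? Q? R? P⊆R Q⊆R P∩Q xs
  with P? x | Q? x | R? x
... | yes px | yes qx | _      = contradiction qx (P∩Q px)
... | yes px | no  _  | no ¬rx = contradiction (P⊆R px) ¬rx
... | no  _  | yes qx | no ¬rx = contradiction (Q⊆R qx) ¬rx
... | yes _  | no  _  | yes _  = s≤s ih
... | no  _  | yes _  | yes _  = ≤-trans (≤-reflexive (+-suc _ _)) (s≤s ih)
... | no  _  | no  _  | yes _  = m≤n⇒m≤1+n ih
... | no  _  | no  _  | no  _  = ih

count-mono : {P Q : Pred A p} (P? : Decidable P) (Q? : Decidable Q) → (∀ {x} → P x → Q x) →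
             ∀ xs → count P? xs ≤ count Q? xs
count-mono P? Q? P⊆Q []       = z≤n
count-mono P? Q? P⊆Q (x ∷ xs) with P? x | Q? x
... | yes _  | yes _  = s≤s (count-mono P? Q? P⊆Q xs)
... | yes px | no ¬qx = contradiction (P⊆Q px) ¬qx
... | no  _  | yes _  = m≤n⇒m≤1+n (count-mono P? Q? P⊆Q xs)
... | no  _  | no  _  = count-mono P? Q? P⊆Q xs

count>0⇒∃ : {P : Pred A p} (P? : Decidable P) → ∀ xs → 0 < count P? xs → ∃ P
count>0⇒∃ P? xs c>0 with filter P? xs | All.all-filter P? xs
... | x ∷ _ | px ∷ _ = x , px

module _ {R : A → B → Set} (R? : Rel.Decidable R) where

  private
    ℕ-+ = +-commutativeSemigroup

  sum-count-∷ : ∀ u us xs → sum (map (λ x → count (flip R? x) (u ∷ us)) xs) ≡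
                count (R? u) xs + sum (map (λ x → count (flip R? x) us) xs)
  sum-count-∷ u us []       = refl
  sum-count-∷ u us (x ∷ xs) with R? u x
  ... | yes _ = cong suc (trans (cong (c +_) (sum-count-∷ u us xs)) (x∙yz≈y∙xz ℕ-+ c (count (R? u) xs) _))
    where c = count (flip R? x) us
  ... | no  _ = trans (cong (c +_) (sum-count-∷ u us xs)) (x∙yz≈y∙xz ℕ-+ c (count (R? u) xs) _)
    where c = count (flip R? x) us

  sum-count-[] : ∀ xs → sum (map (λ x → count (flip R? x) []) xs) ≡ 0
  sum-count-[] []       = refl
  sum-count-[] (x ∷ xs) = sum-count-[] xs

  sum-count-swap : ∀ us xs → sum (map (λ u → count (R? u) xs) us) ≡
                   sum (map (λ x → count (flip R? x) us) xs)
  sum-count-swap []       xs = sym (sum-count-[] xs)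
  sum-count-swap (u ∷ us) xs =
    trans (cong (count (R? u) xs +_) (sum-count-swap us xs)) (sym (sum-count-∷ u us xs))

  private
    lower : ∀ {N K} us xs → (∀ {u} → u ∈ᴸ us → N ≤ K * count (R? u) xs) →
            length us * N ≤ K * sum (map (λ u → count (R? u) xs) us)
    lower []       xs h = z≤n
    lower {N} {K} (u ∷ us) xs h = begin
      N + length us * N                     ≤⟨ +-mono-≤ (h (Any.here refl)) (lower {K = K} us xs (h ∘ Any.there)) ⟩
      K * c + K * s                         ≡⟨ *-distribˡ-+ K c s ⟨
      K * (c + s)                           ∎
      where open ≤-Reasoning
            c = count (R? u) xs
            s = sum (map (λ u → count (R? u) xs) us)

    upper : ∀ {M} us xs → (∀ x → count (flip R? x) us ≤ M) →
            sum (map (λ x → count (flip R? x) us) xs) ≤ length xs * M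
    upper us []       h = z≤n
    upper us (x ∷ xs) h = +-mono-≤ (h x) (upper us xs h)

  -- The related pairs are counted by rows and by columns. The lower bound N/K for a row is
  -- multiplied by K to stay within the natural numbers.
  double-count : ∀ {N K M} us xs →
                 (∀ {u} → u ∈ᴸ us → N ≤ K * count (R? u) xs) →
                 (∀ x → count (flip R? x) us ≤ M) →
                 length us * N ≤ K * (length xs * M)
  double-count {N} {K} {M} us xs deg codeg = begin
    length us * N                                         ≤⟨ lower {K = K} us xs deg ⟩
    K * sum (map (λ u → count (R? u) xs) us)              ≡⟨ cong (K *_) (sum-count-swap us xs) ⟩
    K * sum (map (λ x → count (flip R? x) us) xs)         ≤⟨ *-monoʳ-≤ K (upper us xs codeg) ⟩
    K * (length xs * M)                                   ∎
    where open ≤-Reasoning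

-- Counting subsets; their sizes and members.

count-subsets : ∀ {n} {P : Pred (Subset (suc n)) p} (P? : Decidable P) →
                count P? (subsets (suc n)) ≡
                count (P? ∘ (inside ∷_)) (subsets n) + count (P? ∘ (outside ∷_)) (subsets n)
count-subsets {n = n} P? = trans (count-++ P? (map (inside ∷_) (subsets n)) _)
  (cong₂ _+_ (count-map P? _ (subsets n)) (count-map P? _ (subsets n)))

-- Splitting by the first point gives Pascal's recursion, and n^k + n^(k + 1) = (n + 1) n^k ≤ (n +
-- 1)^(k + 1).
count-sized : ∀ {n k} {P : Pred (Subset n) p} (P? : Decidable P) →
              (∀ S → P S → ∣ S ∣ ≡ k) → count P? (subsets n) ≤ n ^ k
count-sized {n = zero} {zero}  P? sized = List.length-filter P? (subsets 0)
count-sized {n = zero} {suc k} {P} P? sized = ≤-reflexive (count-none P? none (subsets 0))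
  where
  none : ∀ {S} → ¬ P S
  none {[]} pS with () ← sized _ pS
count-sized {n = suc n} {zero} P? sized = begin
  count P? (subsets (suc n))  ≡⟨ count-subsets P? ⟩
  count (P? ∘ (inside ∷_)) (subsets n) + count (P? ∘ (outside ∷_)) (subsets n)
    ≤⟨ +-mono-≤ (≤-reflexive (count-none (P? ∘ (inside ∷_)) (λ pS → 1+n≢0 (sized _ pS)) (subsets n)))
                (count-sized (P? ∘ (outside ∷_)) (λ _ pS → sized _ pS)) ⟩
  1                           ∎
  where open ≤-Reasoning
count-sized {n = suc n} {suc k} P? sized = begin
  count P? (subsets (suc n))  ≡⟨ count-subsets P? ⟩
  count (P? ∘ (inside ∷_)) (subsets n) + count (P? ∘ (outside ∷_)) (subsets n)
    ≤⟨ +-mono-≤ (count-sized (P? ∘ (inside ∷_)) (λ _ pS → suc-injective (sized _ pS)))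
                (count-sized (P? ∘ (outside ∷_)) (λ _ pS → sized _ pS)) ⟩
  suc n * n ^ k               ≤⟨ *-monoʳ-≤ (suc n) (^-monoˡ-≤ k (n≤1+n n)) ⟩
  suc n * suc n ^ k           ∎
  where open ≤-Reasoning

-- A member is given by one of its points in `Y` and k further points. The induction splits by the
-- first point.
count-hitting : ∀ {n k} {P : Pred (Subset n) p} (P? : Decidable P) (Y : Subset n) →
                (∀ S → P S → ∣ S ∣ ≡ suc k × Nonempty (S ∩ Y)) →
                count P? (subsets n) ≤ ∣ Y ∣ * n ^ k
count-hitting {n = zero} {P = P} P? [] hits = ≤-reflexive (count-none P? none (subsets 0))
  where
  none : ∀ {S} → ¬ P S
  none {[]} pS with () ← proj₁ (hits _ pS)
count-hitting {n = suc n} {k} {P = P} P? (y ∷ Y) hits = begin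
  count P? (subsets (suc n))                                                    ≡⟨ count-subsets P? ⟩
  count (P? ∘ (inside ∷_)) (subsets n) + count (P? ∘ (outside ∷_)) (subsets n)  ≤⟨ +-monoʳ-≤ _ outer ⟩
  count (P? ∘ (inside ∷_)) (subsets n) + ∣ Y ∣ * n ^ k                          ≤⟨ inner y hits ⟩
  ∣ y ∷ Y ∣ * suc n ^ k                                                         ∎
  where
  open ≤-Reasoning
  outer : count (P? ∘ (outside ∷_)) (subsets n) ≤ ∣ Y ∣ * n ^ k
  outer = count-hitting _ Y λ _ pS → case (hits _ pS)
    where
    case : ∀ {S} → ∣ S ∣ ≡ suc k × Nonempty ((outside ∷ S) ∩ (y ∷ Y)) →
           ∣ S ∣ ≡ suc k × Nonempty (S ∩ Y)
    case (eq , suc x , there x∈) = eq , x , x∈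
  inner : ∀ y → (∀ S → P S → ∣ S ∣ ≡ suc k × Nonempty (S ∩ (y ∷ Y))) →
          count (P? ∘ (inside ∷_)) (subsets n) + ∣ Y ∣ * n ^ k ≤ ∣ y ∷ Y ∣ * suc n ^ k
  -- The first point already lies in `Y`, so the other k are arbitrary.
  inner true hits = begin
    count (P? ∘ (inside ∷_)) (subsets n) + ∣ Y ∣ * n ^ k
      ≤⟨ +-monoˡ-≤ _ (count-sized (P? ∘ (inside ∷_)) (λ _ pS → suc-injective (proj₁ (hits _ pS)))) ⟩
    suc ∣ Y ∣ * n ^ k        ≤⟨ *-monoʳ-≤ (suc ∣ Y ∣) (^-monoˡ-≤ k (n≤1+n n)) ⟩
    suc ∣ Y ∣ * suc n ^ k    ∎
  -- The first point lies outside `Y`, so the other k points must still meet `Y`: impossible for k =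
  -- 0, and a case of the induction otherwise.
  inner false hits = go k λ _ pS → case (hits _ pS)
    where
    case : ∀ {S} → suc ∣ S ∣ ≡ suc k × Nonempty ((inside ∷ S) ∩ (outside ∷ Y)) →
           ∣ S ∣ ≡ k × Nonempty (S ∩ Y)
    case (eq , suc x , there x∈) = suc-injective eq , x , x∈
    go : ∀ k → (∀ S → P (inside ∷ S) → ∣ S ∣ ≡ k × Nonempty (S ∩ Y)) →
         count (P? ∘ (inside ∷_)) (subsets n) + ∣ Y ∣ * n ^ k ≤ ∣ Y ∣ * suc n ^ k
    go zero hits′ = +-monoˡ-≤ _ (≤-reflexive (count-none _ none (subsets n)))
      where
      none : ∀ {S} → ¬ P (inside ∷ S)
      none {S} pS with eq , x , x∈ ← hits′ _ pS =
        m<n⇒n≢0 (x∈p⇒∣p-x∣<∣p∣ {p = S} (proj₁ (x∈p∩q⁻ _ _ x∈))) eq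
    go (suc k) hits′ = begin
      count (P? ∘ (inside ∷_)) (subsets n) + ∣ Y ∣ * (n * n ^ k)  ≤⟨ +-monoˡ-≤ _ (count-hitting _ Y hits′) ⟩
      ∣ Y ∣ * n ^ k + ∣ Y ∣ * (n * n ^ k)                         ≡⟨ *-distribˡ-+ ∣ Y ∣ (n ^ k) _ ⟨
      ∣ Y ∣ * (suc n * n ^ k)                                     ≤⟨ *-monoʳ-≤ ∣ Y ∣ (*-monoʳ-≤ (suc n) (^-monoˡ-≤ k (n≤1+n n))) ⟩
      ∣ Y ∣ * suc n ^ suc k                                       ∎

∣∣≡count : ∀ {n} (S : Subset n) {P : Pred (Fin n) p} (P? : Decidable P) →
           (∀ {x} → x ∈ S → P x) → (∀ {x} → P x → x ∈ S) →
           ∣ S ∣ ≡ count P? (allFin n)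
∣∣≡count []      P? to from = refl
∣∣≡count {n = suc n} (s ∷ S) P? to from
  with ih ← trans (∣∣≡count S (P? ∘ suc) (to ∘ there) (drop-there ∘ from))
                  (sym (trans (cong (count P?) (sym (List.map-tabulate id suc))) (count-map P? suc (allFin n))))
  with s | P? zero
... | true  | yes _  = cong suc ih
... | true  | no ¬p₀ = contradiction (to here) ¬p₀
... | false | yes p₀ with () ← from p₀
... | false | no _   = ih

module _ {n} {P : Pred (Fin n) p} (P? : Decidable P) where

  ∈-tabulate⁺ : ∀ {x} → P x → x ∈ Vec.tabulate (does ∘ P?)
  ∈-tabulate⁺ {x} px = Vec.lookup⇒[]= x _ (trans (Vec.lookup∘tabulate _ x) (dec-true (P? x) px))

  ∈-tabulate⁻ : ∀ {x} → x ∈ Vec.tabulate (does ∘ P?) → P x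
  ∈-tabulate⁻ {x} x∈ with P? x | trans (sym (Vec.lookup∘tabulate (does ∘ P?) x)) (Vec.[]=⇒lookup x∈)
  ... | yes px | _ = px

∣S[x]≔inside∣ : ∀ {n} (S : Subset n) x → x ∉ S → ∣ S [ x ]≔ inside ∣ ≡ suc ∣ S ∣
∣S[x]≔inside∣ (inside  ∷ S) zero    x∉S = contradiction here x∉S
∣S[x]≔inside∣ (outside ∷ S) zero    x∉S = refl
∣S[x]≔inside∣ (inside  ∷ S) (suc x) x∉S = cong suc (∣S[x]≔inside∣ S x (drop-not-there x∉S))
∣S[x]≔inside∣ (outside ∷ S) (suc x) x∉S = ∣S[x]≔inside∣ S x (drop-not-there x∉S)

∈[]≔inside⁻ : ∀ {n} {S : Subset n} {x y} → y ∈ S [ x ]≔ inside → y ≡ x ⊎ y ∈ S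
∈[]≔inside⁻ {S = S} {x} {y} y∈ with y Fin.≟ x
... | yes y≡x = inj₁ y≡x
... | no  y≢x = inj₂ (Vec.lookup⇒[]= y S
                  (trans (sym (Vec.lookup∘updateAt′ y x y≢x S)) (Vec.[]=⇒lookup y∈)))

-- Cliques as lists, and twins.

module _ {n} (G : Graph n) where
  open Graph G

  -- As lists of pairwise adjacent vertices, cliques are easily extended by a vertex or mapped to
  -- another graph.
  subset⇒list : ∀ {S} → IsClique G S →
                ∃[ xs ] AllPairs _∼_ xs × All (_∈ S) xs × length xs ≡ ∣ S ∣
  subset⇒list {S} clique =
    xs , pairs (filter⁺ (_∈? S) (allFin⁺ n)) xs∈S , xs∈S , sym (∣∣≡count S (_∈? S) id id)
    where
    xs = filter (_∈? S) (allFin n)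
    xs∈S = All.all-filter (_∈? S) (allFin n)
    pairs : ∀ {xs} → Unique xs → All (_∈ S) xs → AllPairs _∼_ xs
    pairs []             []         = []
    pairs (x≢xs ∷ uniq) (x∈ ∷ xs∈) =
      All.zipWith (λ (x≢y , y∈) → clique _ x∈ _ y∈ x≢y) (x≢xs , xs∈) ∷ pairs uniq xs∈

  -- Pairwise adjacency forces distinct entries, adjacency being irreflexive, so no vertex is lost
  -- in passing to a set.
  list⇒subset : ∀ {xs} → AllPairs _∼_ xs →
                ∃[ S ] ∣ S ∣ ≡ length xs × IsClique G S × (∀ {x} → x ∈ S → x ∈ᴸ xs)
  list⇒subset [] = ⊥ , ∣⊥∣≡0 n , (λ _ x∈ → contradiction x∈ ∉⊥) , (λ x∈ → contradiction x∈ ∉⊥)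
  list⇒subset {x ∷ xs} (x∼xs ∷ pairs) with S , ∣S∣ , clique , S⊆xs ← list⇒subset pairs =
    S [ x ]≔ inside , trans (∣S[x]≔inside∣ S x x∉S) (cong suc ∣S∣) , clique′ , members
    where
    x∼ : ∀ {y} → y ∈ S → x ∼ y
    x∼ y∈ = All.lookup x∼xs (S⊆xs y∈)
    x∉S : x ∉ S
    x∉S x∈ = ∼-irrefl (x∼ x∈)
    clique′ : IsClique G (S [ x ]≔ inside)
    clique′ y y∈ z z∈ y≢z with ∈[]≔inside⁻ y∈ | ∈[]≔inside⁻ z∈
    ... | inj₁ refl | inj₁ refl = contradiction refl y≢z
    ... | inj₁ refl | inj₂ z∈S  = x∼ z∈S
    ... | inj₂ y∈S  | inj₁ refl = ∼-sym (x∼ y∈S)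
    ... | inj₂ y∈S  | inj₂ z∈S  = clique y y∈S z z∈S y≢z
    members : ∀ {y} → y ∈ S [ x ]≔ inside → y ∈ᴸ x ∷ xs
    members y∈ with ∈[]≔inside⁻ y∈
    ... | inj₁ y≡x = here y≡x
    ... | inj₂ y∈S = there (S⊆xs y∈S)

  KFree⇒list : ∀ {r} → KFree r G → ∀ {xs} → AllPairs _∼_ xs → length xs ≢ r
  KFree⇒list free pairs len with S , ∣S∣ , clique , _ ← list⇒subset pairs =
    free (S , trans ∣S∣ len , clique)

  list⇒KFree : ∀ {r} → (∀ {xs} → AllPairs _∼_ xs → length xs ≢ r) → KFree r G
  list⇒KFree free (S , ∣S∣ , clique) with _ , pairs , _ , len ← subset⇒list clique =
    free pairs (trans len ∣S∣)

  ∈N⇒∼ : ∀ {u v} → v ∈ N G u → u ∼ v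
  ∈N⇒∼ {u} = ∈-tabulate⁻ (u ∼?_)

  Twin : Fin n → Fin n → Set
  Twin u v = (∀ w → u ∼ w → v ∼ w) × (∀ w → v ∼ w → u ∼ w)

  Twin? : ∀ u v → Dec (Twin u v)
  Twin? u v = Fin.all? (λ w → (u ∼? w) →-dec (v ∼? w)) ×-dec Fin.all? (λ w → (v ∼? w) →-dec (u ∼? w))

-- Lists of pairwise non-twin vertices, with r = 3 + k and d = k + 1.

module _ {n k K} (G : Graph n) (2≤K : 2 ≤ K) (free : KFree (3 + k) G)
  (dense : ∀ u v → u ≢ v → ¬ Adj G u v → n ^ suc k ≤ K * #copies (suc k) G (N G u ∩ N G v))
  where
  open Graph G

  private
    T = n ^ suc k

  Distinguishes : Fin n → Fin n → Fin n → Set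
  Distinguishes z u x = u ∼ x × ¬ z ∼ x

  distinguishes? : ∀ z u x → Dec (Distinguishes z u x)
  distinguishes? z u x = (u ∼? x) ×-dec ¬? (z ∼? x)

  -- Adjoining u and v to S would produce a K_(3 + k).
  ¬common-clique : ∀ {u v S} → u ∼ v → ∣ S ∣ ≡ suc k → IsClique G S →
                   (∀ x → x ∈ S → u ∼ x) → ¬ (∀ x → x ∈ S → v ∼ x)
  ¬common-clique u∼v ∣S∣ clique u∼S v∼S
    with xs , pairs , xs∈S , len ← subset⇒list G clique =
    KFree⇒list G free
      ((u∼v ∷ All.map (u∼S _) xs∈S) ∷ All.map (v∼S _) xs∈S ∷ pairs)
      (cong (2 +_) (trans len ∣S∣))

  module _ .{{_ : NonZero n}} where

    -- Every copy of K_(k + 1) in N(u) ∩ N(w) meets `Y`, by `¬common-clique` for the edge z w.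
    -- `count-hitting` then bounds their number by ∣ Y ∣ n^k, and n^k cancels.
    separated-by : ∀ {z u w} → ¬ z ∼ u → z ∼ w → ¬ u ∼ w →
                   n ≤ K * count (distinguishes? z u) (allFin n)
    separated-by {z} {u} {w} z≁u z∼w u≁w = *-cancelʳ-≤ n _ (n ^ k) {{m^n≢0 n k}} (begin
      n * n ^ k                                            ≤⟨ dense u w u≢w u≁w ⟩
      K * #copies (suc k) G (N G u ∩ N G w)                ≤⟨ *-monoʳ-≤ K (count-hitting _ Y hits) ⟩
      K * (∣ Y ∣ * n ^ k)                                  ≡⟨ *-assoc K ∣ Y ∣ (n ^ k) ⟨
      K * ∣ Y ∣ * n ^ k                                    ≡⟨ cong (λ c → K * c * n ^ k) ∣Y∣ ⟩
      K * count (distinguishes? z u) (allFin n) * n ^ k    ∎)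
      where
      open ≤-Reasoning
      u≢w : u ≢ w
      u≢w refl = z≁u z∼w
      Y = Vec.tabulate (does ∘ distinguishes? z u)
      ∣Y∣ = ∣∣≡count Y (distinguishes? z u) (∈-tabulate⁻ (distinguishes? z u)) (∈-tabulate⁺ (distinguishes? z u))
      hits : ∀ S → IsCopyIn (suc k) G (N G u ∩ N G w) S → ∣ S ∣ ≡ suc k × _
      hits S (S⊆ , ∣S∣ , clique) with Fin.any? (λ x → (x ∈? S) ×-dec ¬? (z ∼? x))
      ... | yes (x , x∈S , z≁x) = ∣S∣ , x ,
        x∈p∩q⁺ (x∈S , ∈-tabulate⁺ (distinguishes? z u) (∈N⇒∼ G (proj₁ (x∈p∩q⁻ _ _ (S⊆ x∈S))) , z≁x))
      ... | no none = contradiction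
        (λ x x∈S → decidable-stable (z ∼? x) λ z≁x → none (x , x∈S , z≁x))
        (¬common-clique (∼-sym z∼w) ∣S∣ clique (λ x x∈S → ∈N⇒∼ G (proj₂ (x∈p∩q⁻ (N G u) _ (S⊆ x∈S)))))

    -- Neighbourhoods of non-adjacent vertices are never strictly nested: if N(z) were strictly
    -- inside N(u), `separated-by` with z and u exchanged would yield a vertex of N(z) outside N(u).
    -- Hence non-twins always provide the w that `separated-by` asks for.
    separated : ∀ {z u} → ¬ z ∼ u → ¬ Twin G z u →
                n ≤ K * count (distinguishes? z u) (allFin n)
    separated {z} {u} z≁u ¬twin with Fin.any? (λ w → (z ∼? w) ×-dec ¬? (u ∼? w))
    ... | yes (w , z∼w , u≁w) = separated-by z≁u z∼w u≁w
    ... | no z⊆u with Fin.any? (distinguishes? z u)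
    ...   | no u⊆z = contradiction
      ( (λ w z∼w → decidable-stable (u ∼? w) λ u≁w → z⊆u (w , z∼w , u≁w))
      , (λ w u∼w → decidable-stable (z ∼? w) λ z≁w → u⊆z (w , u∼w , z≁w)))
      ¬twin
    ...   | yes (w , u∼w , z≁w) = contradiction
      (subst (n ≤_)
        (trans (cong (K *_) (count-none (distinguishes? u z) (λ {x} d → z⊆u (x , d)) (allFin n))) (*-zeroʳ K))
        (separated-by (z≁u ∘ ∼-sym) u∼w z≁w))
      (<⇒≱ (>-nonZero⁻¹ n))

  -- The number of these sets is the potential that drives the induction in `bounded`.
  Covered : List (Fin n) → Subset n → Set
  Covered L S = ∣ S ∣ ≡ suc k × IsClique G S × Any (λ z → ∀ x → x ∈ S → z ∼ x) L

  covered? : ∀ L S → Dec (Covered L S)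
  covered? L S = (∣ S ∣ ≟ suc k) ×-dec isClique? G S ×-dec
    any? (λ z → Fin.all? λ x → (x ∈? S) →-dec (z ∼? x)) L

  #covered : List (Fin n) → ℕ
  #covered L = count (covered? L) (subsets n)

  #covered≤ : ∀ L → #covered L ≤ T
  #covered≤ L = count-sized (covered? L) (λ _ → proj₁)

  #covered-mono : ∀ {L L′} → All (_∈ᴸ L) L′ → #covered L′ ≤ #covered L
  #covered-mono {L} {L′} L′⊆L = count-mono (covered? L′) (covered? L) covered (subsets n)
    where
    covered : ∀ {S} → Covered L′ S → Covered L S
    covered (∣S∣ , clique , any) with z , z∈ , z∼S ← find any =
      ∣S∣ , clique , Any.map (λ { refl → z∼S }) (All.lookup L′⊆L z∈)

  -- `dense` supplies T/K cliques in N(z) ∩ N(x). They are covered through z, but through no v in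
  -- `L′`, by `¬common-clique` for the edge v x.
  #covered-drop : ∀ {L L′ z x} → z ∈ᴸ L → z ≢ x → ¬ z ∼ x →
                  All (_∈ᴸ L) L′ → All (_∼ x) L′ →
                  T + K * #covered L′ ≤ K * #covered L
  #covered-drop {L} {L′} {z} {x} z∈L z≢x z≁x L′⊆L L′∼x = begin
    T + K * #covered L′                                      ≤⟨ +-monoˡ-≤ _ (dense z x z≢x z≁x) ⟩
    K * #copies (suc k) G (N G z ∩ N G x) + K * #covered L′  ≡⟨ *-distribˡ-+ K _ (#covered L′) ⟨
    K * (#copies (suc k) G (N G z ∩ N G x) + #covered L′)    ≤⟨ *-monoʳ-≤ K disjoint ⟩
    K * #covered L                                           ∎
    where
    open ≤-Reasoning
    disjoint : #copies (suc k) G (N G z ∩ N G x) + #covered L′ ≤ #covered L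
    disjoint = count-disjoint (isCopyIn? (suc k) G (N G z ∩ N G x)) (covered? L′) (covered? L)
      (λ (S⊆ , ∣S∣ , clique) → ∣S∣ , clique ,
        Any.map (λ { refl y y∈S → ∈N⇒∼ G (proj₁ (x∈p∩q⁻ _ _ (S⊆ y∈S))) }) z∈L)
      (λ (∣S∣ , clique , any) → let z , z∈ , z∼S = find any in
        ∣S∣ , clique , Any.map (λ { refl → z∼S }) (All.lookup L′⊆L z∈))
      (λ (S⊆ , ∣S∣ , clique) (_ , _ , any) → let y , y∈ , y∼S = find any in
        ¬common-clique (All.lookup L′∼x y∈) ∣S∣ clique y∼S
          (λ w w∈S → ∈N⇒∼ G (proj₂ (x∈p∩q⁻ (N G z) _ (S⊆ w∈S)))))
      (subsets n)

  module _ .{{_ : NonZero n}} where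

    -- Here a limits the further drops of `#covered L` by T/K, and cliques in `L` have fewer than b
    -- vertices. Passing to the neighbours of z lowers b; passing to the vertices of `L₂` adjacent
    -- to some x outside N(z) lowers a.
    bounded : ∀ a b L → AllPairs (λ u v → ¬ Twin G u v) L →
              K * #covered L ≤ a * T →
              (∀ {xs} → AllPairs _∼_ xs → All (_∈ᴸ L) xs → length xs ≢ b) →
              length L ≤ (2 * K) ^ (a + b)
    -- The empty list is a clique of length 0, against ω.
    bounded a zero    L          _             _       ω = contradiction refl (ω [] [])
    bounded a (suc b) []         _             _       ω = z≤n
    bounded a (suc b) L@(z ∷ L₀) (z≢L₀ ∷ L₀≢) covered ω = begin
      suc (length L₀)                     ≡⟨ cong suc (length≡count+count¬ (z ∼?_) L₀) ⟩
      -- The vertex z, its neighbours in `L₀` and the rest of `L₀` contribute at most M, M and K M;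
      -- the first two together stay below K M, as 2 ≤ K.
      1 + (length L₁ + length L₂)         ≤⟨ +-mono-≤ 1≤M (+-mono-≤ ∣L₁∣ ∣L₂∣) ⟩
      M + (M + K * M)                     ≡⟨ +-assoc M M _ ⟨
      (M + M) + K * M                     ≡⟨ cong (λ m → M + m + K * M) (+-identityʳ M) ⟨
      2 * M + K * M                       ≤⟨ +-monoˡ-≤ _ (*-monoˡ-≤ M 2≤K) ⟩
      K * M + K * M                       ≡⟨ *-distribʳ-+ M K K ⟨
      (K + K) * M                         ≡⟨ cong (λ m → (K + m) * M) (+-identityʳ K) ⟨
      (2 * K) ^ suc (a + b)               ≡⟨ cong ((2 * K) ^_) (+-suc a b) ⟨
      (2 * K) ^ (a + suc b)               ∎
      where
      open ≤-Reasoning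
      M = (2 * K) ^ (a + b)
      L₁ = filter (z ∼?_) L₀
      L₂ = filter (¬? ∘ (z ∼?_)) L₀
      D? = distinguishes? z

      ∈L₁⁻ : ∀ {x} → x ∈ᴸ L₁ → x ∈ᴸ L₀ × z ∼ x
      ∈L₁⁻ = ∈-filter⁻ (z ∼?_)

      ∈L₂⁻ : ∀ {x} → x ∈ᴸ L₂ → x ∈ᴸ L₀ × ¬ z ∼ x
      ∈L₂⁻ = ∈-filter⁻ (¬? ∘ (z ∼?_))

      1≤M : 1 ≤ M
      1≤M = m^n>0 (2 * K) {{>-nonZero (≤-trans (s≤s z≤n) (≤-trans 2≤K (m≤m+n K _)))}} (a + b)

      L₁⊆L : All (_∈ᴸ L) L₁
      L₁⊆L = All.tabulate λ x∈ → there (proj₁ (∈L₁⁻ x∈))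

      ∣L₁∣ : length L₁ ≤ M
      ∣L₁∣ = bounded a b L₁ (AllPairs.filter⁺ (z ∼?_) L₀≢)
        (≤-trans (*-monoʳ-≤ K (#covered-mono L₁⊆L)) covered)
        -- A clique of length b in `L₁` would together with z be one of length b + 1 in `L`.
        λ {xs} pairs xs⊆ len → ω {z ∷ xs}
          (All.map (λ x∈ → proj₂ (∈L₁⁻ x∈)) xs⊆ ∷ pairs)
          (here refl ∷ All.map (All.lookup L₁⊆L) xs⊆) (cong suc len)

      -- All of `L′` lies in N(x) while z does not, so `#covered-drop` applies: a decreases, and the
      -- bound on cliques is inherited from `L`.
      all-bounded : ∀ x L′ → All (_∈ᴸ L₂) L′ → All (λ u → Distinguishes z u x) L′ →
                    AllPairs (λ u v → ¬ Twin G u v) L′ → length L′ ≤ M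
      all-bounded x []         _     _                       _   = z≤n
      all-bounded x L′@(u ∷ _) L′⊆L₂ L′D@((u∼x , z≁x) ∷ _) L′≢ = go a covered
        where
        L′⊆L : All (_∈ᴸ L) L′
        L′⊆L = All.map (λ x∈ → there (proj₁ (∈L₂⁻ x∈))) L′⊆L₂

        z≢x : z ≢ x
        z≢x refl = proj₂ (∈L₂⁻ (All.head L′⊆L₂)) (∼-sym u∼x)

        drop : T + K * #covered L′ ≤ K * #covered L
        drop = #covered-drop (here refl) z≢x z≁x L′⊆L (All.map proj₁ L′D)

        go : ∀ a → K * #covered L ≤ a * T → length L′ ≤ (2 * K) ^ (a + b)
        -- For a = 0 the hypothesis gives `K * #covered L` ≤ 0 while `drop` gives at least T > 0, so
        -- a nonempty `L′` cannot occur.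
        go zero    cov = contradiction (≤-trans (m≤m+n T _) (≤-trans drop cov))
                           (<⇒≱ (m^n>0 n (suc k)))
        -- The first parameter falls by one while b + 1 is kept, so the exponent agrees with that of
        -- M.
        go (suc a) cov = subst (λ e → length L′ ≤ (2 * K) ^ e) (+-suc a b)
          (bounded a (suc b) L′ L′≢ (+-cancelˡ-≤ T _ _ (≤-trans drop cov))
            λ pairs xs⊆ → ω pairs (All.map (All.lookup L′⊆L) xs⊆))

      codegree : ∀ x → count (flip D? x) L₂ ≤ M
      codegree x = all-bounded x (filter (flip D? x) L₂)
        (All.tabulate (proj₁ ∘ ∈-filter⁻ (flip D? x)))
        (All.all-filter (flip D? x) L₂)
        (AllPairs.filter⁺ (flip D? x) (AllPairs.filter⁺ (¬? ∘ (z ∼?_)) L₀≢))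

      degree : ∀ {u} → u ∈ᴸ L₂ → n ≤ K * count (D? u) (allFin n)
      degree u∈ with u∈L₀ , z≁u ← ∈L₂⁻ u∈ = separated z≁u (All.lookup z≢L₀ u∈L₀)

      ∣L₂∣ : length L₂ ≤ K * M
      -- Each u in `L₂` is distinguished from z by at least n/K of the n vertices, and each vertex
      -- serves at most M of the u; the factor n cancels.
      ∣L₂∣ = *-cancelʳ-≤ (length L₂) (K * M) n (begin
        length L₂ * n                  ≤⟨ double-count D? {K = K} {M} L₂ (allFin n) degree codegree ⟩
        K * (length (allFin n) * M)    ≡⟨ cong (λ l → K * (l * M)) (List.length-tabulate {n = n} id) ⟩
        K * (n * M)                    ≡⟨ cong (K *_) (*-comm n M) ⟩
        K * (M * n)                    ≡⟨ *-assoc K M n ⟨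
        K * M * n                      ∎)

  twin-free-bound : ∀ L → AllPairs (λ u v → ¬ Twin G u v) L → length L ≤ (2 * K) ^ (K + (3 + k))
  twin-free-bound []        _  = z≤n
  -- At the start a = K because `#covered L` ≤ T, and b = 3 + k because `G` is K_(3 + k)-free. The
  -- vertex z shows that n is not 0.
  twin-free-bound L@(z ∷ _) L≢ = bounded {{Fin.nonZeroIndex z}} K (3 + k) L L≢
    (*-monoʳ-≤ K (#covered≤ L)) (λ pairs _ → KFree⇒list G free pairs)

-- The quotient by twins.

AllPairs-lookup : ∀ {a ℓ} {A : Set a} {R : A → A → Set ℓ} → Symmetric R → ∀ {xs} → AllPairs R xs →
                  ∀ {i j} → i ≢ j → R (lookup xs i) (lookup xs j)
AllPairs-lookup R-sym (x∼xs ∷ pairs) {zero}  {zero}  i≢j = contradiction refl i≢j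
AllPairs-lookup R-sym (x∼xs ∷ pairs) {zero}  {suc j} i≢j = All.lookup x∼xs (∈-lookup j)
AllPairs-lookup R-sym (x∼xs ∷ pairs) {suc i} {zero}  i≢j = R-sym (All.lookup x∼xs (∈-lookup i))
AllPairs-lookup R-sym (x∼xs ∷ pairs) {suc i} {suc j} i≢j = AllPairs-lookup R-sym pairs (i≢j ∘ cong suc)

module _ {n} (G : Graph n) where
  open Graph G

  Twin-decSetoid : DecSetoid 0ℓ 0ℓ
  Twin-decSetoid = record
    { Carrier          = Fin n
    ; _≈_              = Twin G
    ; isDecEquivalence = record
      { isEquivalence = record
        { refl  = (λ _ → id) , (λ _ → id)
        ; sym   = λ (to , from) → from , to
        ; trans = λ (to , from) (to′ , from′) → (λ w → to′ w ∘ to w) , (λ w → from w ∘ from′ w)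
        }
      ; _≟_           = Twin? G
      }
    }

  open DecSetoid Twin-decSetoid using () renaming (refl to Twin-refl; sym to Twin-sym; trans to Twin-trans)

  reps : List (Fin n)
  reps = deduplicate (Twin? G) (allFin n)

  reps-twin-free : AllPairs (λ u v → ¬ Twin G u v) reps
  reps-twin-free = deduplicate-! Twin-decSetoid (allFin n)

  rep : Fin (length reps) → Fin n
  rep = lookup reps

  rep-injective : ∀ {a b} → Twin G (rep a) (rep b) → a ≡ b
  rep-injective {a} {b} twin with a Fin.≟ b
  ... | yes a≡b = a≡b
  ... | no  a≢b = contradiction twin (AllPairs-lookup (_∘ Twin-sym) reps-twin-free a≢b)

  -- Realised as the subgraph of `G` induced on one representative per class, so that cliques map
  -- directly into `G`.
  quotient : Graph (length reps)
  quotient = record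
    { _∼_      = λ a b → rep a ∼ rep b
    ; _∼?_     = λ a b → rep a ∼? rep b
    ; ∼-sym    = ∼-sym
    ; ∼-irrefl = ∼-irrefl
    }

  twin∈reps : ∀ u → Any (Twin G u) reps
  twin∈reps u = Any.deduplicate⁺ (Twin? G) (λ t t′ → Twin-trans t′ (Twin-sym t))
    (Any.map (λ { refl → Twin-refl }) (∈-allFin u))

  class : Fin n → Fin (length reps)
  class u = Any.index (twin∈reps u)

  rep-class : ∀ u → Twin G u (rep (class u))
  rep-class u = Any.lookup-index (twin∈reps u)

  Twin-resp₂ : ∀ {u u′ v v′} → Twin G u u′ → Twin G v v′ → u ∼ v → u′ ∼ v′
  Twin-resp₂ (u⇒u′ , _) (v⇒v′ , _) u∼v = ∼-sym (v⇒v′ _ (∼-sym (u⇒u′ _ u∼v)))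

  isBlowUp : G IsBlowUpOf quotient
  isBlowUp = record
    { part        = class
    ; nonempty    = λ a → rep a , sym (rep-injective (rep-class (rep a)))
    -- An edge within a class would turn into a loop at its representative.
    ; independent = λ u v same u∼v → ∼-irrefl
        (subst (λ a → rep (class u) ∼ rep a) (sym same) (Twin-resp₂ (rep-class u) (rep-class v) u∼v))
    ; complete    = λ u v → Twin-resp₂ (Twin-sym (rep-class u)) (Twin-sym (rep-class v))
    ; no-others   = λ u v → Twin-resp₂ (rep-class u) (rep-class v)
    }

  quotient-free : ∀ {r} → KFree r G → KFree r quotient
  quotient-free free = list⇒KFree quotient λ {as} pairs len →
    KFree⇒list G free (AllPairs.map⁺ pairs) (trans (List.length-map rep as) len)

  -- Here k is r - 2. A K_k in the common neighbourhood of the representatives of a and b maps under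
  -- `class` to a clique of the quotient that is joined to a and b; the new edge completes it to a
  -- K_(2 + k).
  quotient-maximal : ∀ {k} → KFree (2 + k) G →
    (∀ u v → u ≢ v → ¬ u ∼ v → 0 < #copies k G (N G u ∩ N G v)) →
    MaximalKFree (2 + k) quotient
  quotient-maximal {k} free common = record { free = quotient-free free ; maximal = maximal }
    where
    adj : ∀ {c x} → rep c ∼ x → rep c ∼ rep (class x)
    adj {x = x} c∼x = ∼-sym (proj₁ (rep-class x) _ (∼-sym c∼x))

    common∈ : ∀ {a b S} → (∀ {x} → x ∈ S → x ∈ N G (rep a) ∩ N G (rep b)) →
              ∀ {x} → x ∈ S → rep a ∼ x × rep b ∼ x
    common∈ {a} S⊆ x∈S with a∋ , b∋ ← x∈p∩q⁻ (N G (rep a)) _ (S⊆ x∈S) = ∈N⇒∼ G a∋ , ∈N⇒∼ G b∋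

    maximal : ∀ a b (a≢b : a ≢ b) → ¬ rep a ∼ rep b → ContainsK (2 + k) (addEdge quotient a b a≢b)
    maximal a b a≢b a≁b
      with S , S⊆ , ∣S∣ , clique ← count>0⇒∃ (isCopyIn? k G _) (subsets n)
             (common (rep a) (rep b) (λ eq → a≢b (rep-injective (subst (Twin G (rep a)) eq Twin-refl))) a≁b)
      with xs , pairs , xs∈S , len ← subset⇒list G clique
      with T , ∣T∣ , cliqueT , _ ← list⇒subset (addEdge quotient a b a≢b) {a ∷ b ∷ map class xs}
        ( (inj₂ (inj₁ (refl , refl)) ∷ All.map⁺ (All.map (inj₁ ∘ adj ∘ proj₁ ∘ common∈ S⊆) xs∈S))
        ∷ All.map⁺ (All.map (inj₁ ∘ adj ∘ proj₂ ∘ common∈ S⊆) xs∈S)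
        ∷ AllPairs.map⁺ (AllPairs.map (inj₁ ∘ Twin-resp₂ (rep-class _) (rep-class _)) pairs))
      = T , trans ∣T∣ (cong (2 +_) (trans (List.length-map class xs) (trans len ∣S∣))) , cliqueT

theorem1p6 : ∃[ C ] ((r : ℕ) → 3 ≤ r → (ε : ℝ) → Positive ε →
    (n : ℕ) (G : Graph n) → KFree r G →
    ((u v : Fin n) → u ≢ v → ¬ Adj G u v →
    ε · n ^ (r ∸ 2) ≤ⁿ #copies (r ∸ 2) G (N G u ∩ N G v)) →
    ∃[ m ] ∃[ F ] (MaximalKFree {m} r F × G IsBlowUpOf F × m ≤ᶜ vertexBound C r ε))
theorem1p6 = 34 , λ where
  .(3 + k) (s≤s (s≤s (s≤s (z≤n {k})))) ε ε>0 n G free dense →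
    let j , Lj , Uj = dyadic-approx ε ε>0
        -- This exceeds 1/ε, as 1/2^(2 + j) < ε. For j > 0 also ε < 1/2^j, so that K < 4/ε.
        K           = 2 ^ (2 + j)
        dense′ : ∀ u v → u ≢ v → ¬ Adj G u v → n ^ suc k ≤ K * #copies (suc k) G (N G u ∩ N G v)
        dense′ = λ u v u≢v u≁v → ·≤ⁿ⇒≤ ε (2 + j) Lj (dense u v u≢v u≁v)
    in length (reps G) , quotient G
     , quotient-maximal G free (λ u v u≢v u≁v →
         -- The vertex u makes n^(k + 1) positive, so by `dense′` some copy exists.
         n≢0⇒n>0 λ c≡0 → <⇒≱ (m^n>0 n {{Fin.nonZeroIndex u}} (suc k))
           (≤-trans (dense′ u v u≢v u≁v) (≤-reflexive (trans (cong (K *_) c≡0) (*-zeroʳ K)))))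
     , isBlowUp G
     , bound-dyadic ε {k = k} Uj
         (twin-free-bound G (*-monoʳ-≤ 2 (m^n>0 2 (1 + j))) free dense′ (reps G) (reps-twin-free G))
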